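{- Let $G$ and $H$ be finite simple graphs with nonempty vertex sets. Then $\alpha^o(G\,\square\,H)=\max\{\alpha^o(G),\alpha^o(H)\}$, where $G\,\square\,H$ is the Cartesian product of $G$ and $H$.
   Context: All graphs are simple, with finite and nonempty vertex set; $V(G)$ and $E(G)$ denote the vertex set and edge set of $G$. Circular altitude: a linear ordering of $V(G)$ is a bijection $\mathcal{U}:\{1,2,\ldots,|V(G)|\}\to V(G)$; write $u_i=\mathcal{U}(i)$. A $\mathcal{U}$-monotonic cycle of length $m$ ($m\ge 1$) is a sequence $u_{i_1},u_{i_2},\ldots,u_{i_m}$ of $m$ pairwise distinct vertices of $G$ such that, whenever $m>1$: (i) $i_1<i_2<\cdots<i_m$; (ii) $u_{i_t}$ and $u_{i_{t+1}}$ are adjacent for each $1\le t\le m-1$; (iii) $u_{i_m}$ and $u_{i_1}$ are adjacent. (So a single vertex is a monotonic cycle of length $1$, and an edge gives one of length $2$.) Let $|\mathcal{U}|$ denote the maximum length of a $\mathcal{U}$-monotonic cycle. The circular altitude $\alpha^o(G)$ is the minimum of $|\mathcal{U}|$ over all linear orderings $\mathcal{U}$ of $V(G)$. Cartesian product: $G\,\square\,H$ is the graph with vertex set $V(G)\times V(H)$ in which $(v_1,h_1)$ and $(v_2,h_2)$ are adjacent if and only if either $v_1=v_2$ and $h_1h_2\in E(H)$, or $h_1=h_2$ and $v_1v_2\in E(G)$. -}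

module Defs where

open import Data.Fin.Base as Fin using (Fin; toℕ)
open import Data.Fin.Properties as Fin using (any?; all?; *↔×; injective⇒≤)
open import Data.Nat.Base
open import Data.Nat.Properties
  using ( _≟_; _<?_; _≤?_; ≤-refl; ≤-antisym; <-irrefl
        ; m≤n⇒m<n∨m≡n; m<1+n⇒m≤n; m*n≢0)
open import Data.Product.Base using (∃; _×_; _,_; proj₁; proj₂)
open import Data.Product.Function.NonDependent.Propositional using (_×-↔_)
open import Data.Sum.Base as Sum using (_⊎_; inj₁; inj₂)
open import Data.Vec.Functional using (_∷_; head; tail)
open import Function.Base using (_∘_)
open import Function.Bundles
  using (_↔_; _⤖_; mk⤖; module Inverse; module Bijection)
open import Function.Construct.Composition using (_↔-∘_)
open import Function.Consequences.Propositional
  using (strictlySurjective⇒surjective; surjective⇒strictlySurjective)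
open import Function.Definitions using (Injective; Bijective)
open import Function.Properties.Inverse using (↔⇒⤖)
open import Level using (0ℓ)
open import Relation.Binary.Core using (Rel)
open import Relation.Binary.Definitions
  using (Decidable; DecidableEquality; Symmetric; Irreflexive; _Respects_)
open import Relation.Binary.PropositionalEquality
open import Relation.Nullary.Decidable
  using (Dec; yes; no; map′; _×-dec_; _⊎-dec_; _→-dec_)
open import Relation.Nullary.Negation using (contradiction)
import Relation.Unary as U

-- Finiteness is an explicit enumeration, so that equality of vertices is
-- decidable. Adjacency is required to be decidable: for a finite graph this
-- is automatic classically, and constructively it is what makes the extremal
-- quantities below exist.

record Graph : Set₁ where
  infix 4 _~_ _~?_ _≟ⱽ_
  field
    Vertex      : Set
    order       : ℕ
    enumeration : Fin order ↔ Vertex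
    nonempty    : NonZero order
    _~_         : Rel Vertex 0ℓ
    _~?_        : Decidable _~_
    ~-sym       : Symmetric _~_
    ~-irrefl    : Irreflexive _≡_ _~_

  _≟ⱽ_ : DecidableEquality Vertex
  v ≟ⱽ w = map′ from-injective (cong from) (from v Fin.≟ from w)
    where
    open Inverse enumeration using (to; from; strictlyInverseˡ)
    from-injective : from v ≡ from w → v ≡ w
    from-injective eq =
      trans (sym (strictlyInverseˡ v)) (trans (cong to eq) (strictlyInverseˡ w))

open Graph using (Vertex; order)

infixr 7 _□_

_□_ : Graph → Graph → Graph
G □ H = record
  { Vertex      = G.Vertex × H.Vertex
  ; order       = G.order * H.order
  ; enumeration = (G.enumeration ×-↔ H.enumeration) ↔-∘ *↔×
  ; nonempty    = m*n≢0 G.order H.order {{G.nonempty}} {{H.nonempty}}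
  ; _~_         = λ { (v₁ , h₁) (v₂ , h₂) →
                      (v₁ ≡ v₂ × h₁ H.~ h₂) ⊎ (h₁ ≡ h₂ × v₁ G.~ v₂) }
  ; _~?_        = λ { (v₁ , h₁) (v₂ , h₂) →
                      ((v₁ G.≟ⱽ v₂) ×-dec (h₁ H.~? h₂)) ⊎-dec
                      ((h₁ H.≟ⱽ h₂) ×-dec (v₁ G.~? v₂)) }
  ; ~-sym       = λ { (inj₁ (v≡ , h~)) → inj₁ (sym v≡ , H.~-sym h~)
                    ; (inj₂ (h≡ , v~)) → inj₂ (sym h≡ , G.~-sym v~) }
  ; ~-irrefl    = λ { refl (inj₁ (_ , h~)) → H.~-irrefl refl h~
                    ; refl (inj₂ (_ , v~)) → G.~-irrefl refl v~ }
  }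
  where
  module G = Graph G
  module H = Graph H

IsMaximum : (ℕ → Set) → ℕ → Set
IsMaximum P n = P n × (∀ {k} → P k → k ≤ n)

IsMinimum : (ℕ → Set) → ℕ → Set
IsMinimum P n = P n × (∀ {k} → P k → n ≤ k)

-- Positions are counted from 0.

LinearOrdering : Graph → Set
LinearOrdering G = Fin (order G) ⤖ Vertex G

module _ (G : Graph) where
  open Graph G using (_~_)

  -- The sequence consists of the vertices u (i t). Since t and s range over
  -- Fin m, "t follows s" is toℕ t ≡ suc (toℕ s), the first term has
  -- toℕ s ≡ 0 and the last has suc (toℕ t) ≡ m.

  record IsMonotonicCycle (𝒰 : LinearOrdering G) {m : ℕ}
                          (i : Fin m → Fin (order G)) : Set where
    open Bijection 𝒰 using () renaming (to to u)
    field
      length≥1   : 1 ≤ m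
      distinct   : Injective _≡_ _≡_ (u ∘ i)
      increasing : 1 < m → ∀ s t → toℕ t ≡ suc (toℕ s) → i s Fin.< i t
      path       : 1 < m → ∀ s t → toℕ t ≡ suc (toℕ s) → u (i s) ~ u (i t)
      closed     : 1 < m → ∀ s t → toℕ s ≡ 0 → suc (toℕ t) ≡ m →
                   u (i t) ~ u (i s)

  HasMonotonicCycle : LinearOrdering G → ℕ → Set
  HasMonotonicCycle 𝒰 m =
    ∃ λ (i : Fin m → Fin (order G)) → IsMonotonicCycle 𝒰 i

-- Existence of the extremal quantities, by exhaustive search.

private
  anyFunction? : ∀ {m n} {P : (Fin m → Fin n) → Set} →
                 P Respects _≗_ → U.Decidable P → Dec (∃ P)
  anyFunction? {zero} resp P? =
    map′ (_ ,_) (λ { (_ , Pf) → resp (λ ()) Pf }) (P? λ ())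
  anyFunction? {suc m} {n} {P} resp P? =
    map′ (λ { (x , f , p) → x ∷ f , p })
         (λ { (f , p) → head f , tail f ,
                        resp (λ { Fin.zero → refl ; (Fin.suc _) → refl }) p })
         (any? λ x → anyFunction? (resp ∘ ∷-cong x) (P? ∘ (x ∷_)))
    where
    ∷-cong : ∀ x {f g : Fin m → Fin n} → f ≗ g → (x ∷ f) ≗ (x ∷ g)
    ∷-cong x f≗g Fin.zero    = refl
    ∷-cong x f≗g (Fin.suc j) = f≗g j

  maximum : ∀ {P : ℕ → Set} → U.Decidable P → ∀ {k} → P k →
            ∀ b → (∀ {j} → P j → j ≤ b) → ∃ (IsMaximum P)
  maximum P? p zero bound with bound p
  ... | z≤n = 0 , p , bound
  maximum {P} P? p (suc b) bound with P? (suc b)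
  ... | yes q = suc b , q , bound
  ... | no ¬q = maximum P? p b bound′
    where
    bound′ : ∀ {j} → P j → j ≤ b
    bound′ r with m≤n⇒m<n∨m≡n (bound r)
    ... | inj₁ j<1+b = m<1+n⇒m≤n j<1+b
    ... | inj₂ refl  = contradiction r ¬q

  minimum : ∀ {P : ℕ → Set} → U.Decidable P → ∀ {k} → P k → ∃ (IsMinimum P)
  minimum {P} P? {k} p =
    Sum.[ (λ bound → k , p , bound) , (λ found → found) ]′ (below k)
    where
    below : ∀ n → (∀ {j} → P j → n ≤ j) ⊎ ∃ (IsMinimum P)
    below zero = inj₁ λ _ → z≤n
    below (suc n) with below n
    ... | inj₂ found = inj₂ found
    ... | inj₁ bound with P? n
    ...   | yes q = inj₂ (n , q , bound)
    ...   | no ¬q = inj₁ bound′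
      where
      bound′ : ∀ {j} → P j → suc n ≤ j
      bound′ r with m≤n⇒m<n∨m≡n (bound r)
      ... | inj₁ n<j  = n<j
      ... | inj₂ refl = contradiction r ¬q

  maximum-unique : ∀ {P Q : ℕ → Set} {m n} →
                   (∀ {k} → P k → Q k) → (∀ {k} → Q k → P k) →
                   IsMaximum P m → IsMaximum Q n → m ≡ n
  maximum-unique P⇒Q Q⇒P (p , ub) (q , ub′) =
    ≤-antisym (ub′ (P⇒Q p)) (ub (Q⇒P q))

module _ (G : Graph) where
  open Graph G using (_~_; _~?_; _≟ⱽ_; enumeration)
  open Inverse enumeration using (to; from; strictlyInverseˡ)
  open IsMonotonicCycle

  private
    cycle-resp : ∀ (𝒰 𝒱 : LinearOrdering G) → Bijection.to 𝒰 ≗ Bijection.to 𝒱 →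
                 ∀ {m} {i j : Fin m → Fin (order G)} → i ≗ j →
                 IsMonotonicCycle G 𝒰 i → IsMonotonicCycle G 𝒱 j
    cycle-resp 𝒰 𝒱 u≗v {m} {i} {j} i≗j c = record
      { length≥1   = length≥1 c
      ; distinct   = λ {s} {t} eq →
                       distinct c (trans (same s) (trans eq (sym (same t))))
      ; increasing = λ 1<m s t eq →
                       subst₂ Fin._<_ (i≗j s) (i≗j t) (increasing c 1<m s t eq)
      ; path       = λ 1<m s t eq →
                       subst₂ _~_ (same s) (same t) (path c 1<m s t eq)
      ; closed     = λ 1<m s t eq eq′ →
                       subst₂ _~_ (same t) (same s) (closed c 1<m s t eq eq′)
      }
      where
      same : ∀ s → Bijection.to 𝒰 (i s) ≡ Bijection.to 𝒱 (j s)
      same s = trans (u≗v (i s)) (cong (Bijection.to 𝒱) (i≗j s))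

    isMonotonicCycle? : ∀ (𝒰 : LinearOrdering G) {m} (i : Fin m → Fin (order G)) →
                        Dec (IsMonotonicCycle G 𝒰 i)
    isMonotonicCycle? 𝒰 {m} i =
      map′ (λ { (n , d , a , p , c) → record
                { length≥1 = n ; distinct = d _ _ ; increasing = a
                ; path = p ; closed = c } })
           (λ c → length≥1 c , (λ _ _ → distinct c) , increasing c
                , path c , closed c)
           (   (1 ≤? m)
         ×-dec (all? λ s → all? λ t → (u (i s) ≟ⱽ u (i t)) →-dec (s Fin.≟ t))
         ×-dec ((1 <? m) →-dec all? λ s → all? λ t →
                 (toℕ t ≟ suc (toℕ s)) →-dec (i s Fin.<? i t))
         ×-dec ((1 <? m) →-dec all? λ s → all? λ t →
                 (toℕ t ≟ suc (toℕ s)) →-dec (u (i s) ~? u (i t)))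
         ×-dec ((1 <? m) →-dec all? λ s → all? λ t →
                 (toℕ s ≟ 0) →-dec ((suc (toℕ t) ≟ m) →-dec
                 (u (i t) ~? u (i s)))))
      where open Bijection 𝒰 using () renaming (to to u)

    hasMonotonicCycle? : (𝒰 : LinearOrdering G) →
                         U.Decidable (HasMonotonicCycle G 𝒰)
    hasMonotonicCycle? 𝒰 m =
      anyFunction? (cycle-resp 𝒰 𝒰 λ _ → refl) (isMonotonicCycle? 𝒰)

    trivialCycle : (𝒰 : LinearOrdering G) → HasMonotonicCycle G 𝒰 1
    trivialCycle 𝒰 = (λ _ → first (Graph.nonempty G)) , record
      { length≥1   = ≤-refl
      ; distinct   = λ { {Fin.zero} {Fin.zero} _ → refl }
      ; increasing = λ 1<1 → contradiction 1<1 (<-irrefl refl)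
      ; path       = λ 1<1 → contradiction 1<1 (<-irrefl refl)
      ; closed     = λ 1<1 → contradiction 1<1 (<-irrefl refl)
      }
      where
      first : ∀ {n} → NonZero n → Fin n
      first {suc _} _ = Fin.zero

  longestCycle : (𝒰 : LinearOrdering G) → ∃ (IsMaximum (HasMonotonicCycle G 𝒰))
  longestCycle 𝒰 =
    maximum (hasMonotonicCycle? 𝒰) (trivialCycle 𝒰) (order G)
      λ (i , c) → injective⇒≤ (distinct c ∘ cong (Bijection.to 𝒰))

  maxCycleLength : LinearOrdering G → ℕ
  maxCycleLength 𝒰 = proj₁ (longestCycle 𝒰)

  AttainedLength : ℕ → Set
  AttainedLength a = ∃ λ (𝒰 : LinearOrdering G) → maxCycleLength 𝒰 ≡ a

  private
    maxCycleLength-cong : ∀ (𝒰 𝒱 : LinearOrdering G) →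
                          Bijection.to 𝒰 ≗ Bijection.to 𝒱 →
                          maxCycleLength 𝒰 ≡ maxCycleLength 𝒱
    maxCycleLength-cong 𝒰 𝒱 u≗v = maximum-unique
      (λ (i , c) → i , cycle-resp 𝒰 𝒱 u≗v (λ _ → refl) c)
      (λ (i , c) → i , cycle-resp 𝒱 𝒰 (sym ∘ u≗v) (λ _ → refl) c)
      (proj₂ (longestCycle 𝒰)) (proj₂ (longestCycle 𝒱))

    bijective? : (u : Fin (order G) → Vertex G) → Dec (Bijective _≡_ _≡_ u)
    bijective? u =
      map′ (λ (inj , surj) → inj _ _ , strictlySurjective⇒surjective λ v →
              proj₁ (surj (from v)) ,
              trans (proj₂ (surj (from v))) (strictlyInverseˡ v))
           (λ (inj , surj) → (λ _ _ → inj) , λ j →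
              surjective⇒strictlySurjective surj (to j))
           (   (all? λ j → all? λ k → (u j ≟ⱽ u k) →-dec (j Fin.≟ k))
         ×-dec (all? λ j → any? λ k → u k ≟ⱽ to j))

    attainedLength? : U.Decidable AttainedLength
    attainedLength? a =
      map′ (λ (σ , b , eq) → mk⤖ b , eq)
           (λ (𝒰 , eq) → let σ = from ∘ Bijection.to 𝒰
                             𝒰≗ = λ k → strictlyInverseˡ (Bijection.to 𝒰 k)
                             b = bij-resp (sym ∘ 𝒰≗) (Bijection.bijective 𝒰)
                         in σ , b , trans (maxCycleLength-cong (mk⤖ b) 𝒰 𝒰≗) eq)
           (anyFunction? Q-resp Q?)
      where
      Q : (Fin (order G) → Fin (order G)) → Set
      Q σ = ∃ λ (b : Bijective _≡_ _≡_ (to ∘ σ)) → maxCycleLength (mk⤖ b) ≡ a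

      bij-resp : ∀ {u v : Fin (order G) → Vertex G} → u ≗ v →
                 Bijective _≡_ _≡_ u → Bijective _≡_ _≡_ v
      bij-resp u≗v (inj , surj) =
        (λ {x} {y} eq → inj (trans (u≗v x) (trans eq (sym (u≗v y))))) ,
        strictlySurjective⇒surjective λ w →
          let x , eq = surjective⇒strictlySurjective surj w
          in x , trans (sym (u≗v x)) eq

      Q-resp : Q Respects _≗_
      Q-resp σ≗τ (b , eq) =
        b′ , trans (maxCycleLength-cong (mk⤖ b′) (mk⤖ b) (sym ∘ cong to ∘ σ≗τ)) eq
        where b′ = bij-resp (cong to ∘ σ≗τ) b

      Q? : U.Decidable Q
      Q? σ with bijective? (to ∘ σ)
      ... | no ¬b = no (¬b ∘ proj₁)
      ... | yes b = map′ (b ,_)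
        (λ (b′ , eq) → trans (maxCycleLength-cong (mk⤖ b) (mk⤖ b′) (λ _ → refl)) eq)
        (maxCycleLength (mk⤖ b) ≟ a)

  leastAttainedLength : ∃ (IsMinimum AttainedLength)
  leastAttainedLength =
    minimum attainedLength? (↔⇒⤖ enumeration , refl)

  α° : ℕ
  α° = proj₁ leastAttainedLength

{-# OPTIONS --safe #-}

-- Order the vertices of G □ H lexicographically by optimal orderings of G and
-- H. Along a monotonic cycle both coordinates then weakly increase. The closing
-- edge fixes one coordinate, so this coordinate has the same value at both ends
-- and is constant throughout: the cycle lies in a fibre, which is a copy of G
-- or of H. Conversely G and H embed in G □ H, and every ordering of a graph
-- restricts to its subgraphs.

module Submission where

open import Defs
open import Data.Fin.Base using (Fin; zero; suc; toℕ; fromℕ; remQuot; punchIn; _<_; _≤_)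
open import Data.Fin.Permutation using (Permutation′; id; insert; insert-punchIn; _⟨$⟩ʳ_)
open import Data.Fin.Properties
  using ( *↔×; <-trans; <-cmp; <⇒≢; ≤-reflexive; ≤-trans; ≤-antisym
        ; ≤-totalOrder; ≤∧≢⇒<; ≤fromℕ; toℕ-fromℕ; toℕ-injective; toℕ-combine
        ; combine-remQuot; punchIn-injective; punchInᵢ≢i)
open import Data.List.Base using (allFin)
import Data.List.Extrema as Extrema
open import Data.List.Membership.Propositional.Properties using (∈-allFin)
import Data.List.Relation.Unary.All as All
open import Data.Nat.Base as ℕ using (_⊔_; s≤s; z≤n; s<s)
import Data.Nat.Properties as ℕ
open import Data.Product.Base using (∃; _×_; _,_; proj₁; proj₂)
open import Data.Product.Function.NonDependent.Propositional using (_×-⤖_)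
open import Data.Sum.Base using (_⊎_; inj₁; inj₂; [_,_]′)
open import Function.Base using (_∘_; const)
open import Function.Bundles using (module Bijection; module Inverse)
open import Function.Construct.Composition using (_⤖-∘_)
open import Function.Definitions using (Injective)
open import Function.Properties.Bijection using (⤖⇒↔)
open import Function.Properties.Inverse using (↔⇒⤖)
open import Relation.Binary.Core using (Rel)
open import Relation.Binary.Definitions using (Transitive; tri<; tri≈; tri>)
open import Relation.Binary.PropositionalEquality
open import Relation.Nullary.Negation using (contradiction)

open Graph using (Vertex; order; enumeration; nonempty; ~-sym)
open Bijection using (to; injective)
open IsMonotonicCycle

-- Monotone sequences on `Fin`.

stepwise⇒monotone : ∀ {a ℓ} {A : Set a} {R : Rel A ℓ} → Transitive R →
                    ∀ {m} (f : Fin m → A) →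
                    (∀ s t → toℕ t ≡ ℕ.suc (toℕ s) → R (f s) (f t)) →
                    ∀ {s t} → s < t → R (f s) (f t)
stepwise⇒monotone {R = R} R-trans f step {zero} {suc zero} _ = step zero (suc zero) refl
-- The only case that composes: the first step, then the induction started at index 1.
stepwise⇒monotone {R = R} R-trans f step {zero} {suc (suc t)} _ =
  R-trans (step zero (suc zero) refl)
          (stepwise⇒monotone {R = R} R-trans (f ∘ suc) (λ s t → step (suc s) (suc t) ∘ cong ℕ.suc)
             {zero} {suc t} (s≤s z≤n))
stepwise⇒monotone {R = R} R-trans f step {suc s} {suc t} (s<s s<t) =
  stepwise⇒monotone {R = R} R-trans (f ∘ suc) (λ s t → step (suc s) (suc t) ∘ cong ℕ.suc) s<t

stepwise-≤⇒monotone : ∀ {m n} (f : Fin m → Fin n) →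
                      (∀ s t → toℕ t ≡ ℕ.suc (toℕ s) → f s ≤ f t) →
                      ∀ {s t} → s ≤ t → f s ≤ f t
stepwise-≤⇒monotone f step s≤t with ℕ.m≤n⇒m<n∨m≡n s≤t
... | inj₁ s<t = stepwise⇒monotone {R = _≤_} ≤-trans f step s<t
... | inj₂ s≡t = ≤-reflexive (cong f (toℕ-injective s≡t))

strictlyMonotone⇒injective : ∀ {m n} {f : Fin m → Fin n} →
                             (∀ {s t} → s < t → f s < f t) → Injective _≡_ _≡_ f
strictlyMonotone⇒injective mono {s} {t} eq with <-cmp s t
... | tri< s<t _ _ = contradiction eq (<⇒≢ (mono s<t))
... | tri≈ _ s≡t _ = s≡t
... | tri> _ _ t<s = contradiction (sym eq) (<⇒≢ (mono t<s))

-- Sorting an injection.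

least : ∀ {m n} (f : Fin (ℕ.suc m) → Fin n) → ∃ λ j → ∀ k → f j ≤ f k
least {m} {n} f = argmin f zero (allFin _) , λ k →
  All.lookup (f[argmin]≤f[xs] {f = f} zero (allFin _)) (∈-allFin k)
  where open Extrema (≤-totalOrder n) using (argmin; f[argmin]≤f[xs])

-- The inductive step of selection sort: `insert zero j π` sends `zero` to the minimiser `j` and
-- `suc t` to `punchIn j` of `π` at `t`. Injectivity makes the minimum strict.
insert-sorts : ∀ {m n} {f : Fin (ℕ.suc m) → Fin n} → Injective _≡_ _≡_ f →
               ∀ j → (∀ k → f j ≤ f k) → (π : Permutation′ m) →
               (∀ {s t} → s < t → f (punchIn j (π ⟨$⟩ʳ s)) < f (punchIn j (π ⟨$⟩ʳ t))) →
               ∀ {s t} → s < t → f (insert zero j π ⟨$⟩ʳ s) < f (insert zero j π ⟨$⟩ʳ t)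
insert-sorts {f = f} inj j j-least π sorted {zero} {suc t} _ =
  subst (λ k → f j < f k) (sym (insert-punchIn zero j π t))
    (≤∧≢⇒< (j-least _) (punchInᵢ≢i j _ ∘ sym ∘ inj))
insert-sorts {f = f} inj j j-least π sorted {suc s} {suc t} (s<s s<t) =
  subst₂ (λ k l → f k < f l) (sym (insert-punchIn zero j π s)) (sym (insert-punchIn zero j π t))
    (sorted s<t)

sortingPermutation : ∀ {m n} (f : Fin m → Fin n) → Injective _≡_ _≡_ f →
                     ∃ λ (π : Permutation′ m) → ∀ {s t} → s < t → f (π ⟨$⟩ʳ s) < f (π ⟨$⟩ʳ t)
sortingPermutation {ℕ.zero} f inj = id , λ { {()} }
sortingPermutation {ℕ.suc m} f inj =
  let j , j-least = least f
      π , sorted  = sortingPermutation (f ∘ punchIn j) (λ {k} {l} → punchIn-injective j k l ∘ inj)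
  in insert zero j π , insert-sorts inj j j-least π sorted

-- Extremal cycle lengths.

module _ (G : Graph) (𝒰 : LinearOrdering G) where

  maxCycleLength-attained : HasMonotonicCycle G 𝒰 (maxCycleLength G 𝒰)
  maxCycleLength-attained = proj₁ (proj₂ (longestCycle G 𝒰))

  length≤maxCycleLength : ∀ {m} → HasMonotonicCycle G 𝒰 m → m ℕ.≤ maxCycleLength G 𝒰
  length≤maxCycleLength = proj₂ (proj₂ (longestCycle G 𝒰))

  α°≤maxCycleLength : α° G ℕ.≤ maxCycleLength G 𝒰
  α°≤maxCycleLength = proj₂ (proj₂ (leastAttainedLength G)) (𝒰 , refl)

  -- Length 1 is handled apart, because the fibre argument below relies on a closing edge.
  singletonCycle : (i : Fin 1 → Fin (order G)) → IsMonotonicCycle G 𝒰 i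
  singletonCycle i = record
    { length≥1   = ℕ.≤-refl
    ; distinct   = λ { {zero} {zero} _ → refl }
    ; increasing = λ 1<1 → contradiction 1<1 (ℕ.<-irrefl refl)
    ; path       = λ 1<1 → contradiction 1<1 (ℕ.<-irrefl refl)
    ; closed     = λ 1<1 → contradiction 1<1 (ℕ.<-irrefl refl)
    }

α°-attained : (G : Graph) → AttainedLength G (α° G)
α°-attained G = proj₁ (proj₂ (leastAttainedLength G))

-- Monotonic cycles inside a fibre.

module _ (K : Graph) (𝒲 : LinearOrdering K) where
  open Graph K using () renaming (_~_ to _~ᴷ_)

  module _ {m} {i : Fin (ℕ.suc (ℕ.suc m)) → Fin (order K)} (c : IsMonotonicCycle K 𝒲 i) where

    last : Fin (ℕ.suc (ℕ.suc m))
    last = fromℕ (ℕ.suc m)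

    -- Oriented from the lower to the higher position, so that it can be treated like the edges of
    -- the path.
    closingEdge : to 𝒲 (i zero) ~ᴷ to 𝒲 (i last)
    closingEdge = ~-sym K (closed c (s<s (s≤s z≤n)) zero last refl (cong ℕ.suc (toℕ-fromℕ _)))

    first<last : i zero < i last
    first<last = stepwise⇒monotone {R = _<_} <-trans i (increasing c (s<s (s≤s z≤n)))
                   {zero} {last} (s≤s z≤n)

  -- q plays the role of a projection whose fibres are copies of L, with p the
  -- position within a fibre.
  module _ (L : Graph) (𝒱 : LinearOrdering L)
           {n} (p : Fin (order K) → Fin (order L)) (q : Fin (order K) → Fin n) where
    open Graph L using () renaming (_~_ to _~ᴸ_)

    WithinFibre : Rel (Fin (order K)) _
    WithinFibre k l = q k ≡ q l × p k < p l × to 𝒱 (p k) ~ᴸ to 𝒱 (p l)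

    module _ (edge : ∀ {k l} → k < l → to 𝒲 k ~ᴷ to 𝒲 l → WithinFibre k l ⊎ q k < q l) where

      fibreEdge : ∀ {k l} → k < l → to 𝒲 k ~ᴷ to 𝒲 l → q k ≡ q l → WithinFibre k l
      fibreEdge k<l k~l qk≡ql with edge k<l k~l
      ... | inj₁ within = within
      ... | inj₂ qk<ql  = contradiction qk≡ql (<⇒≢ qk<ql)

      -- No forward edge lowers `q`, so equal values at the two ends make `q` constant along the
      -- cycle. Every edge then falls under the first alternative of `edge`, which gives the growth
      -- of `p` and adjacency in `L`.
      fibreCycle : ∀ {m} {i : Fin (ℕ.suc (ℕ.suc m)) → Fin (order K)}
                   (c : IsMonotonicCycle K 𝒲 i) → q (i zero) ≡ q (i (last c)) →
                   IsMonotonicCycle L 𝒱 (p ∘ i)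
      fibreCycle {m} {i} c ends = record
        { length≥1   = s≤s z≤n
        ; distinct   = strictlyMonotone⇒injective
                         (stepwise⇒monotone {R = _<_} <-trans (p ∘ i) p-increasing)
                       ∘ injective 𝒱
        ; increasing = const p-increasing
        ; path       = λ _ s t eq → proj₂ (proj₂ (step s t eq))
        -- The closing edge also stays in the fibre, by `ends`; the two equations identify `s` and
        -- `t` with its endpoints.
        ; closed     = λ _ s t s≡0 t≡m →
            subst₂ (λ s t → to 𝒱 (p (i t)) ~ᴸ to 𝒱 (p (i s)))
              (toℕ-injective (sym s≡0))
              (toℕ-injective (trans (toℕ-fromℕ _) (sym (ℕ.suc-injective t≡m))))
              (~-sym L (proj₂ (proj₂ (fibreEdge (first<last c) (closingEdge c) ends))))
        }
        where
        i-increasing = increasing c (s<s (s≤s z≤n))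
        i-path       = path c (s<s (s≤s z≤n))

        q-step : ∀ s t → toℕ t ≡ ℕ.suc (toℕ s) → q (i s) ≤ q (i t)
        q-step s t eq with edge (i-increasing s t eq) (i-path s t eq)
        ... | inj₁ (q≡ , _) = ≤-reflexive q≡
        ... | inj₂ q<       = ℕ.<⇒≤ q<

        -- Each value is squeezed between those at the first and last index, which agree.
        q-constant : ∀ s → q (i s) ≡ q (i zero)
        q-constant s = ≤-antisym
          (≤-trans (stepwise-≤⇒monotone (q ∘ i) q-step (≤fromℕ s)) (≤-reflexive (sym ends)))
          (stepwise-≤⇒monotone (q ∘ i) q-step {zero} {s} z≤n)

        step : ∀ s t → toℕ t ≡ ℕ.suc (toℕ s) → WithinFibre (i s) (i t)
        step s t eq = fibreEdge (i-increasing s t eq) (i-path s t eq)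
                        (trans (q-constant s) (sym (q-constant t)))

        p-increasing : ∀ s t → toℕ t ≡ ℕ.suc (toℕ s) → p (i s) < p (i t)
        p-increasing s t eq = proj₁ (proj₂ (step s t eq))

-- Monotonicity of the circular altitude.

module _ (G K : Graph) where
  open Graph G using () renaming (_~_ to _~ᴳ_)
  open Graph K using () renaming (_~_ to _~ᴷ_)

  -- List the vertices of `G` by the positions of their images in an optimal ordering of `K`; then
  -- `φ` carries monotonic cycles to monotonic cycles of the same length.
  α°-mono : (φ : Vertex G → Vertex K) → Injective _≡_ _≡_ φ →
            (∀ {v w} → v ~ᴳ w → φ v ~ᴷ φ w) → α° G ℕ.≤ α° K
  α°-mono φ φ-injective φ-edge = let 𝒲 , eq = α°-attained K in
    ℕ.≤-trans (restricted 𝒲) (ℕ.≤-reflexive eq)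
    where
    restricted : ∀ 𝒲 → α° G ℕ.≤ maxCycleLength K 𝒲
    restricted 𝒲 = ℕ.≤-trans (α°≤maxCycleLength G 𝒰)
                     (length≤maxCycleLength K 𝒲 (image (maxCycleLength-attained G 𝒰)))
      where
      open Inverse (⤖⇒↔ 𝒲) using (from; strictlyInverseˡ)

      position : Fin (order G) → Fin (order K)
      position = from ∘ φ ∘ Inverse.to (enumeration G)

      position-injective : Injective _≡_ _≡_ position
      position-injective eq = injective (↔⇒⤖ (enumeration G)) (φ-injective
        (trans (sym (strictlyInverseˡ _)) (trans (cong (to 𝒲) eq) (strictlyInverseˡ _))))

      sorting = sortingPermutation position position-injective

      𝒰 : LinearOrdering G
      𝒰 = ↔⇒⤖ (enumeration G) ⤖-∘ ↔⇒⤖ (proj₁ sorting)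

      image : ∀ {m} → HasMonotonicCycle G 𝒰 m → HasMonotonicCycle K 𝒲 m
      image {ℕ.zero} (_ , c) = contradiction (length≥1 c) λ ()
      image {ℕ.suc ℕ.zero} (i , _) = from ∘ φ ∘ to 𝒰 ∘ i , singletonCycle K 𝒲 _
      image {ℕ.suc (ℕ.suc _)} (i , c) = from ∘ φ ∘ to 𝒰 ∘ i ,
        -- With `q` constant, the whole of `G` is a single fibre, and `p` is increasing by the
        -- choice of `𝒰`.
        fibreCycle G 𝒰 K 𝒲 (from ∘ φ ∘ to 𝒰) (const (zero {0}))
          (λ k<l k~l → inj₁ (refl , proj₂ sorting k<l ,
            subst₂ _~ᴷ_ (sym (strictlyInverseˡ _)) (sym (strictlyInverseˡ _)) (φ-edge k~l)))
          c refl

element : (G : Graph) → Vertex G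
element G = Inverse.to (enumeration G) (first (nonempty G))
  where
  first : ∀ {n} → ℕ.NonZero n → Fin n
  first {ℕ.suc _} _ = zero

-- The lexicographic ordering of the product.

module _ (G H : Graph) (𝒰 : LinearOrdering G) (𝒱 : LinearOrdering H) where

  -- `*↔×` splits a position into quotient and remainder by `order H`, so the usual order on `Fin`
  -- is lexicographic with the `G`-coordinate leading.
  lexicographic : LinearOrdering (G □ H)
  lexicographic = (𝒰 ×-⤖ 𝒱) ⤖-∘ ↔⇒⤖ *↔×

  private
    x : Fin (order (G □ H)) → Fin (order G)
    x = proj₁ ∘ remQuot (order H)

    y : Fin (order (G □ H)) → Fin (order H)
    y = proj₂ ∘ remQuot {order G} (order H)

    toℕ-xy : ∀ k → toℕ k ≡ order H ℕ.* toℕ (x k) ℕ.+ toℕ (y k)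
    toℕ-xy k = trans (cong toℕ (sym (combine-remQuot {order G} (order H) k)))
                     (toℕ-combine (x k) (y k))

  -- Write both positions as in `toℕ-xy` and cancel the common summand; the next lemma does the same
  -- with the remainder.
  same-x⇒y-< : ∀ {k l} → k < l → x k ≡ x l → y k < y l
  same-x⇒y-< {k} {l} k<l x≡ = ℕ.+-cancelˡ-< (order H ℕ.* toℕ (x k)) _ _
    (subst₂ ℕ._<_ (toℕ-xy k)
      (trans (toℕ-xy l) (cong (λ z → order H ℕ.* toℕ z ℕ.+ toℕ (y l)) (sym x≡))) k<l)

  same-y⇒x-< : ∀ {k l} → k < l → y k ≡ y l → x k < x l
  same-y⇒x-< {k} {l} k<l y≡ = ℕ.*-cancelˡ-< (order H) _ _ (ℕ.+-cancelʳ-< (toℕ (y k)) _ _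
    (subst₂ ℕ._<_ (toℕ-xy k)
      (trans (toℕ-xy l) (cong (λ z → order H ℕ.* toℕ (x l) ℕ.+ toℕ z) (sym y≡))) k<l))

  -- The coordinate fixed by the closing edge takes the role of `q`, and the other one that of `p`.
  factorCycle : ∀ {m} → HasMonotonicCycle (G □ H) lexicographic m →
                HasMonotonicCycle G 𝒰 m ⊎ HasMonotonicCycle H 𝒱 m
  factorCycle {ℕ.zero} (_ , c) = contradiction (length≥1 c) λ ()
  factorCycle {ℕ.suc ℕ.zero} (i , _) = inj₁ (x ∘ i , singletonCycle G 𝒰 _)
  factorCycle {ℕ.suc (ℕ.suc _)} (i , c) with closingEdge (G □ H) lexicographic c
  ... | inj₁ (v≡ , _) = inj₂ (y ∘ i ,
          fibreCycle (G □ H) lexicographic H 𝒱 y x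
            (λ { k<l (inj₁ (v≡ , h~)) → let x≡ = injective 𝒰 v≡ in
                                        inj₁ (x≡ , same-x⇒y-< k<l x≡ , h~)
               ; k<l (inj₂ (h≡ , _))  → inj₂ (same-y⇒x-< k<l (injective 𝒱 h≡)) })
            c (injective 𝒰 v≡))
  ... | inj₂ (h≡ , _) = inj₁ (x ∘ i ,
          fibreCycle (G □ H) lexicographic G 𝒰 x y
            -- Lexicographic order alone allows `y` to drop, but only when `x` changes; an edge that
            -- changes `x` keeps `y` fixed.
            (λ { k<l (inj₁ (v≡ , _))  → inj₂ (same-x⇒y-< k<l (injective 𝒰 v≡))
               ; k<l (inj₂ (h≡ , v~)) → let y≡ = injective 𝒱 h≡ in
                                        inj₁ (y≡ , same-y⇒x-< k<l y≡ , v~) })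
            c (injective 𝒱 h≡))

  maxCycleLength-lexicographic :
    maxCycleLength (G □ H) lexicographic ℕ.≤ maxCycleLength G 𝒰 ⊔ maxCycleLength H 𝒱
  maxCycleLength-lexicographic = [ ℕ.m≤n⇒m≤n⊔o _ ∘ length≤maxCycleLength G 𝒰
                                 , ℕ.m≤n⇒m≤o⊔n _ ∘ length≤maxCycleLength H 𝒱
                                 ]′ (factorCycle (maxCycleLength-attained (G □ H) lexicographic))

theorem3 : (G H : Graph) → α° (G □ H) ≡ α° G ⊔ α° H
theorem3 G H = ℕ.≤-antisym upper (ℕ.⊔-lub lowerᴳ lowerᴴ)
  where
  upper : α° (G □ H) ℕ.≤ α° G ⊔ α° H
  upper = let 𝒰 , eq = α°-attained G ; 𝒱 , eq′ = α°-attained H in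
    ℕ.≤-trans (α°≤maxCycleLength (G □ H) (lexicographic G H 𝒰 𝒱))
      (ℕ.≤-trans (maxCycleLength-lexicographic G H 𝒰 𝒱) (ℕ.≤-reflexive (cong₂ _⊔_ eq eq′)))

  lowerᴳ : α° G ℕ.≤ α° (G □ H)
  -- A factor embeds as the fibre over one vertex of the other factor, which exists by nonemptiness.
  lowerᴳ = α°-mono G (G □ H) (_, element H) (cong proj₁) λ v~ → inj₂ (refl , v~)

  lowerᴴ : α° H ℕ.≤ α° (G □ H)
  lowerᴴ = α°-mono H (G □ H) (element G ,_) (cong proj₂) λ h~ → inj₁ (refl , h~)
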